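{- (a) The monoidal preorder $\sqsubseteq$ of any idempotent residuated chain $\mathbf A$ is laced and compatible with $\langle A,\le\rangle$. (b) For any chain $\mathbf C=\langle C,\wedge,\vee\rangle$ and any laced preorder $\sqsubseteq$ on $C$ that is compatible with $\mathbf C$, with $\sqsubseteq$-greatest element $\mathrm e$, the algebra $\langle C,\wedge,\vee,\cdot,\mathrm e\rangle$ is an idempotent totally ordered monoid, where $$x\cdot y=\begin{cases}x&\text{if }x\sqsubseteq y,\\ y&\text{otherwise.}\end{cases}$$ Moreover, if $\mathbf C$ is finite, then $\cdot$ has (uniquely determined) residuals $\backslash$ and $/$, and $\langle C,\wedge,\vee,\cdot,\backslash,/,\mathrm e\rangle$ is an idempotent residuated chain.
   Context: A residuated lattice is an algebra $\mathbf A=\langle A,\wedge,\vee,\cdot,\backslash,/,\mathrm e\rangle$ such that $\langle A,\wedge,\vee\rangle$ is a lattice, $\langle A,\cdot,\mathrm e\rangle$ is a monoid, and for all $a,b,c\in A$: $b\le a\backslash c\iff a\cdot b\le c\iff a\le c/b$. It is idempotent if $aa=a$ for all $a$, and a residuated chain if its lattice order is total. An idempotent totally ordered monoid is a chain with an idempotent monoid operation that is order-preserving in both arguments. The monoidal preorder of an idempotent residuated lattice is: $x\sqsubseteq y$ iff $xy=x$. For a preorder $\sqsubseteq$ on a set, write $x\,{\sqsubseteq\sqsupseteq}\,y$ if $x\sqsubseteq y$ and $y\sqsubseteq x$, and $x\parallel y$ if neither $x\sqsubseteq y$ nor $y\sqsubseteq x$. A preorder $\sqsubseteq$ on a set $A$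 is laced if: 1. it has a unique greatest element, denoted $\mathrm e$; 2. for each $a\in A$, either every other element $b\neq a$ is comparable with $a$ and is not $\sqsubseteq$-equivalent to $a$ (i.e. not $a\,{\sqsubseteq\sqsupseteq}\,b$), in which case put $a^\sharp:=a$; or there is a unique element $a^\sharp\ne a$ such that $a\,{\sqsubseteq\sqsupseteq}\,a^\sharp$ or $a\parallel a^\sharp$; 3. for all $a\in A$ and $x\in A\setminus\{a,a^\sharp\}$: $a\sqsubseteq x\iff a^\sharp\sqsubseteq x$, and $x\sqsubseteq a\iff x\sqsubseteq a^\sharp$. A laced preorder $\sqsubseteq$ on $C$ (with greatest element $\mathrm e$) is compatible with a chain $\langle C,\le\rangle$ if: 1. any least element of $\langle C,\le\rangle$ is also the unique least element of $\sqsubseteq$; 2. for all $x,y\in C$ with $\mathrm e\le x,y$: $x\le y\iff y\sqsubseteq x$; 3. for all $x,y\in C$ with $x,y\le\mathrm e$: $x\le y\iff x\sqsubseteq y$; 4. for each $x\in C$ with $x\neq x^\sharp$: $\mathrm e\le x\iff x^\sharp\le\mathrm e$. -}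

module Defs where

open import Algebra.Core using (Op₁; Op₂)
open import Algebra.Definitions using (Idempotent)
open import Algebra.Structures using (IsMonoid; IsIdempotentMonoid)
open import Data.Bool.Base using (if_then_else_)
open import Data.Fin.Base using (Fin)
open import Data.Nat.Base using (ℕ)
open import Data.Product using (∃; ∃!; _×_; proj₁)
open import Data.Sum.Base using (_⊎_; [_,_]′)
open import Function.Base using (const)
open import Function.Bundles using (_⇔_; Inverse)
open import Level using (Level; _⊔_; suc)
open import Relation.Binary.Bundles using (Setoid)
open import Relation.Binary.Core using (Rel)
open import Relation.Binary.Definitions using (Decidable; Maximum; Minimum; Monotonic₂; Total)
open import Relation.Binary.Lattice using (IsLattice)
open import Relation.Binary.PropositionalEquality.Properties using (setoid)
open import Relation.Binary.Structures using (IsPreorder)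
open import Relation.Nullary.Decidable.Core using (does)
open import Relation.Nullary.Negation.Core using (¬_)

-- As in the standard library, carriers are setoids: equality, uniqueness and
-- "other than" all refer to _≈_.

module _ {c ℓ₁ ℓ₂ : Level} {A : Set c} (_≈_ : Rel A ℓ₁) (_≤_ : Rel A ℓ₂) where

  record IsChain (_∨_ _∧_ : Op₂ A) : Set (c ⊔ ℓ₁ ⊔ ℓ₂) where
    field
      isLattice : IsLattice _≈_ _≤_ _∨_ _∧_
      total     : Total _≤_

    open IsLattice isLattice public

  record IsIdempotentTotallyOrderedMonoid (_∨_ _∧_ _·_ : Op₂ A) (e : A)
         : Set (c ⊔ ℓ₁ ⊔ ℓ₂) where
    field
      isChain            : IsChain _∨_ _∧_
      isIdempotentMonoid : IsIdempotentMonoid _≈_ _·_ e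
      ·-mono             : Monotonic₂ _≤_ _≤_ _≤_ _·_

module _ {c ℓ : Level} {A : Set c} (_≤_ : Rel A ℓ) (_·_ : Op₂ A) where

  IsLeftResidual : Op₂ A → Set (c ⊔ ℓ)
  IsLeftResidual _\\_ = ∀ x y z → y ≤ (x \\ z) ⇔ (x · y) ≤ z

  IsRightResidual : Op₂ A → Set (c ⊔ ℓ)
  IsRightResidual _//_ = ∀ x y z → (x · y) ≤ z ⇔ x ≤ (z // y)

module _ {c ℓ₁ ℓ₂ : Level} {A : Set c} (_≈_ : Rel A ℓ₁) (_≤_ : Rel A ℓ₂) where

  record IsResiduatedLattice (_∨_ _∧_ _·_ _\\_ _//_ : Op₂ A) (e : A)
         : Set (c ⊔ ℓ₁ ⊔ ℓ₂) where
    field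
      isLattice       : IsLattice _≈_ _≤_ _∨_ _∧_
      isMonoid        : IsMonoid _≈_ _·_ e
      isLeftResidual  : IsLeftResidual _≤_ _·_ _\\_
      isRightResidual : IsRightResidual _≤_ _·_ _//_

  record IsIdempotentResiduatedChain (_∨_ _∧_ _·_ _\\_ _//_ : Op₂ A) (e : A)
         : Set (c ⊔ ℓ₁ ⊔ ℓ₂) where
    field
      isResiduatedLattice : IsResiduatedLattice _∨_ _∧_ _·_ _\\_ _//_ e
      idem                : Idempotent _≈_ _·_
      total               : Total _≤_

    open IsResiduatedLattice isResiduatedLattice public

record Chain (c ℓ₁ ℓ₂ : Level) : Set (suc (c ⊔ ℓ₁ ⊔ ℓ₂)) where
  infix  4 _≈_ _≤_
  infixr 6 _∨_
  infixr 7 _∧_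
  field
    Carrier : Set c
    _≈_     : Rel Carrier ℓ₁
    _≤_     : Rel Carrier ℓ₂
    _∨_     : Op₂ Carrier
    _∧_     : Op₂ Carrier
    isChain : IsChain _≈_ _≤_ _∨_ _∧_

  open IsChain isChain public

  ≈-setoid : Setoid c ℓ₁
  ≈-setoid = record { isEquivalence = isEquivalence }

record IdempotentResiduatedChain (c ℓ₁ ℓ₂ : Level) : Set (suc (c ⊔ ℓ₁ ⊔ ℓ₂)) where
  infix  4 _≈_ _≤_ _⊑_
  infixr 6 _∨_
  infixr 7 _∧_ _·_
  infixl 7 _\\_ _//_
  field
    Carrier : Set c
    _≈_     : Rel Carrier ℓ₁
    _≤_     : Rel Carrier ℓ₂
    _∨_     : Op₂ Carrier
    _∧_     : Op₂ Carrier
    _·_     : Op₂ Carrier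
    _\\_    : Op₂ Carrier
    _//_    : Op₂ Carrier
    e       : Carrier
    isIdempotentResiduatedChain :
      IsIdempotentResiduatedChain _≈_ _≤_ _∨_ _∧_ _·_ _\\_ _//_ e

  open IsIdempotentResiduatedChain isIdempotentResiduatedChain public

  _⊑_ : Rel Carrier ℓ₁
  x ⊑ y = x · y ≈ x

module _ {c ℓ₁ ℓ₃ : Level} {A : Set c} (_≈_ : Rel A ℓ₁) (_⊑_ : Rel A ℓ₃) where

  infix 4 _⊑⊒_ _∥_

  _⊑⊒_ : Rel A ℓ₃
  x ⊑⊒ y = (x ⊑ y) × (y ⊑ x)

  _∥_ : Rel A ℓ₃
  x ∥ y = ¬ (x ⊑ y) × ¬ (y ⊑ x)

  IsSolitary : A → Set (c ⊔ ℓ₁ ⊔ ℓ₃)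
  IsSolitary a = ∀ b → ¬ (b ≈ a) → (a ⊑ b ⊎ b ⊑ a) × ¬ (a ⊑⊒ b)

  IsPartner : A → A → Set (ℓ₁ ⊔ ℓ₃)
  IsPartner a b = ¬ (b ≈ a) × (a ⊑⊒ b ⊎ a ∥ b)

  record IsLaced : Set (c ⊔ ℓ₁ ⊔ ℓ₃) where
    infix 30 _♯
    field
      isPreorder         : IsPreorder _≈_ _⊑_
      greatest           : ∃! _≈_ (Maximum _⊑_)
      solitary-or-paired : ∀ a → IsSolitary a ⊎ ∃! _≈_ (IsPartner a)

    e : A
    e = proj₁ greatest

    _♯ : Op₁ A
    a ♯ = [ const a , proj₁ ]′ (solitary-or-paired a)

    field
      ♯-above : ∀ a x → ¬ (x ≈ a) → ¬ (x ≈ a ♯) → a ⊑ x ⇔ a ♯ ⊑ x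
      ♯-below : ∀ a x → ¬ (x ≈ a) → ¬ (x ≈ a ♯) → x ⊑ a ⇔ x ⊑ a ♯

module _ {c ℓ₁ ℓ₂ ℓ₃ : Level} {A : Set c} {_≈_ : Rel A ℓ₁} {_⊑_ : Rel A ℓ₃}
         (_≤_ : Rel A ℓ₂) (laced : IsLaced _≈_ _⊑_) where

  open IsLaced laced using (e; _♯)

  record IsCompatible : Set (c ⊔ ℓ₁ ⊔ ℓ₂ ⊔ ℓ₃) where
    field
      least    : ∀ b → Minimum _≤_ b → Minimum _⊑_ b × (∀ y → Minimum _⊑_ y → y ≈ b)
      positive : ∀ x y → e ≤ x → e ≤ y → x ≤ y ⇔ y ⊑ x
      negative : ∀ x y → x ≤ e → y ≤ e → x ≤ y ⇔ x ⊑ y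
      opposite : ∀ x → ¬ (x ≈ x ♯) → e ≤ x ⇔ x ♯ ≤ e

-- The case distinction needs a decision procedure for _⊑_; excluded middle
-- supplies one for every relation.
product : ∀ {c ℓ} {A : Set c} {_⊑_ : Rel A ℓ} → Decidable _⊑_ → Op₂ A
product _⊑?_ x y = if does (x ⊑? y) then x else y

IsFinite : ∀ {c ℓ} → Setoid c ℓ → Set (c ⊔ ℓ)
IsFinite S = ∃ λ (n : ℕ) → Inverse S (setoid (Fin n))

PointwiseEqual₂ : ∀ {c ℓ} {A : Set c} → Rel A ℓ → Rel (Op₂ A) (c ⊔ ℓ)
PointwiseEqual₂ _≈_ f g = ∀ x y → f x y ≈ g x y

{-# OPTIONS --safe #-}

-- In an idempotent totally ordered monoid, x · y is the meet of x and y when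
-- x · y ≤ e and their join when e ≤ x · y.  Hence · is conservative, and elements
-- on the same side of e commute.  Partners are exactly the distinct pairs that
-- do not commute, so they lie on opposite sides of e; two partners b, c of a
-- commute with each other and, being Green-equivalent to a, coincide.
--
-- Conversely, modulo a ~ a ♯ a laced preorder is a linear order, and the product
-- picks the lower of two elements, acting as a left-zero or right-zero band on
-- each class {a , a ♯}; this gives associativity.  Monotonicity compares the
-- positions relative to e.  In the finite case the ≤-least element is
-- absorbing, so each {y | x · y ≤ z} is a nonempty finite down-set of a chain,
-- hence principal.

module Submission where

open import Defs
open import Axiom.ExcludedMiddle using (ExcludedMiddle)
open import Data.Product using (Σ; ∃; ∃!; _×_; _,_; proj₁; proj₂)
open import Relation.Binary.Core using (Rel)
open import Algebra.Core using (Op₂)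
open import Algebra.Structures using (IsMonoid; IsIdempotentMonoid)
open import Data.List.Base using (List; filter; map; allFin)
import Data.List.Extrema as Extrema
open import Data.List.Membership.Propositional using (_∈_)
open import Data.List.Membership.Propositional.Properties
  using (∈-allFin; ∈-filter⁺; ∈-map⁺)
import Data.List.Relation.Unary.All as All
open import Data.List.Relation.Unary.All.Properties using (all-filter)
import Data.Product as Product
open import Data.Sum.Base as Sum using (_⊎_; inj₁; inj₂; [_,_]′)
open import Function.Base using (id; const; _∘_)
open import Function.Bundles using (_⇔_; Equivalence; Inverse; mk⇔)
import Function.Properties.Equivalence as ⇔
open import Relation.Binary.Bundles using (Poset; TotalOrder)
open import Relation.Binary.Definitions
  using (Decidable; Maximum; Minimum; Monotonic₂)
open import Relation.Binary.Lattice using (IsLattice; JoinSemilattice; MeetSemilattice)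
import Relation.Binary.Lattice.Properties.JoinSemilattice as JoinProperties
import Relation.Binary.Lattice.Properties.MeetSemilattice as MeetProperties
open import Relation.Binary.PropositionalEquality.Core as ≡ using (_≡_)
import Relation.Binary.Reasoning.PartialOrder as PartialOrderReasoning
import Relation.Binary.Reasoning.Setoid as SetoidReasoning
open import Relation.Binary.Structures using (IsPreorder)
open import Relation.Nullary.Decidable.Core using (yes; no)
open import Relation.Nullary.Negation.Core using (¬_; contradiction)
import Relation.Unary as Unary

open Equivalence using (to; from)

-- Idempotent residuated chains: products as meets and joins.

module MonoidalPreorder {c ℓ₁ ℓ₂} (𝐀 : IdempotentResiduatedChain c ℓ₁ ℓ₂) where

  open IdempotentResiduatedChain 𝐀
  open IsLattice isLattice
  open IsMonoid isMonoid using (assoc; identityˡ; identityʳ; setoid)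
    renaming (∙-congˡ to ·-congˡ; ∙-congʳ to ·-congʳ)

  private
    joinSemilattice : JoinSemilattice c ℓ₁ ℓ₂
    joinSemilattice = record { isJoinSemilattice = isJoinSemilattice }

    meetSemilattice : MeetSemilattice c ℓ₁ ℓ₂
    meetSemilattice = record { isMeetSemilattice = isMeetSemilattice }

    poset : Poset c ℓ₁ ℓ₂
    poset = record { isPartialOrder = isPartialOrder }

    Partner : Rel Carrier ℓ₁
    Partner = IsPartner _≈_ _⊑_

  open JoinProperties joinSemilattice using (∨-comm; x≤y⇒x∨y≈y)
  open MeetProperties meetSemilattice using (∧-comm; y≤x⇒x∧y≈y)

  -- Residuation gives `x′ ≤ (x′ · y) // y`; prefix this with `x ≤ x′` and residuate back.
  ·-monoˡ : ∀ {x x′} y → x ≤ x′ → x · y ≤ x′ · y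
  ·-monoˡ {x} {x′} y x≤x′ =
    from (isRightResidual x y (x′ · y))
      (trans x≤x′ (to (isRightResidual x′ y (x′ · y)) refl))

  ·-monoʳ : ∀ x {y y′} → y ≤ y′ → x · y ≤ x · y′
  ·-monoʳ x {y} {y′} y≤y′ =
    to (isLeftResidual x y (x · y′))
      (trans y≤y′ (from (isLeftResidual x y′ (x · y′)) refl))

  ·-mono : Monotonic₂ _≤_ _≤_ _≤_ _·_
  ·-mono {x} {x′} {y} {y′} x≤x′ y≤y′ = trans (·-monoˡ y x≤x′) (·-monoʳ x′ y≤y′)

  x·xy≈xy : ∀ x y → x · (x · y) ≈ x · y
  x·xy≈xy x y = Eq.trans (Eq.sym (assoc x x y)) (·-congʳ (idem x))

  xy·y≈xy : ∀ x y → (x · y) · y ≈ x · y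
  xy·y≈xy x y = Eq.trans (assoc x y y) (·-congˡ (idem y))

  -- Idempotence repeats a factor: `x · y` is `x · (x · y)`, and bounding the inner product by `e`
  -- leaves `x`; likewise for `y`. Conversely, the meet is its own square, which lies below `x · y`.
  xy≤e⇒xy≈x∧y : ∀ {x y} → x · y ≤ e → x · y ≈ x ∧ y
  xy≤e⇒xy≈x∧y {x} {y} xy≤e = antisym (∧-greatest xy≤x xy≤y) x∧y≤xy
    where
    open PartialOrderReasoning poset
    xy≤x : x · y ≤ x
    xy≤x = begin
      x · y        ≈⟨ x·xy≈xy x y ⟨
      x · (x · y)  ≤⟨ ·-monoʳ x xy≤e ⟩
      x · e        ≈⟨ identityʳ x ⟩
      x            ∎
    xy≤y : x · y ≤ y
    xy≤y = begin
      x · y        ≈⟨ xy·y≈xy x y ⟨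
      (x · y) · y  ≤⟨ ·-monoˡ y xy≤e ⟩
      e · y        ≈⟨ identityˡ y ⟩
      y            ∎
    x∧y≤xy : x ∧ y ≤ x · y
    x∧y≤xy = begin
      x ∧ y              ≈⟨ idem (x ∧ y) ⟨
      (x ∧ y) · (x ∧ y)  ≤⟨ ·-mono (x∧y≤x x y) (x∧y≤y x y) ⟩
      x · y              ∎

  e≤xy⇒xy≈x∨y : ∀ {x y} → e ≤ x · y → x · y ≈ x ∨ y
  e≤xy⇒xy≈x∨y {x} {y} e≤xy = antisym xy≤x∨y (∨-least x≤xy y≤xy)
    where
    open PartialOrderReasoning poset
    x≤xy : x ≤ x · y
    x≤xy = begin
      x            ≈⟨ identityʳ x ⟨
      x · e        ≤⟨ ·-monoʳ x e≤xy ⟩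
      x · (x · y)  ≈⟨ x·xy≈xy x y ⟩
      x · y        ∎
    y≤xy : y ≤ x · y
    y≤xy = begin
      y            ≈⟨ identityˡ y ⟨
      e · y        ≤⟨ ·-monoˡ y e≤xy ⟩
      (x · y) · y  ≈⟨ xy·y≈xy x y ⟩
      x · y        ∎
    xy≤x∨y : x · y ≤ x ∨ y
    xy≤x∨y = begin
      x · y              ≤⟨ ·-mono (x≤x∨y x y) (y≤x∨y x y) ⟩
      (x ∨ y) · (x ∨ y)  ≈⟨ idem (x ∨ y) ⟩
      x ∨ y              ∎

  ∧-sel : ∀ x y → x ∧ y ≈ x ⊎ x ∧ y ≈ y
  ∧-sel x y with total x y
  ... | inj₁ x≤y = inj₁ (Eq.trans (∧-comm x y) (y≤x⇒x∧y≈y x≤y))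
  ... | inj₂ y≤x = inj₂ (y≤x⇒x∧y≈y y≤x)

  ∨-sel : ∀ x y → x ∨ y ≈ x ⊎ x ∨ y ≈ y
  ∨-sel x y with total x y
  ... | inj₁ x≤y = inj₂ (x≤y⇒x∨y≈y x≤y)
  ... | inj₂ y≤x = inj₁ (Eq.trans (∨-comm x y) (x≤y⇒x∨y≈y y≤x))

  ·-sel : ∀ x y → x · y ≈ x ⊎ x · y ≈ y
  ·-sel x y with total (x · y) e
  ... | inj₁ xy≤e = Sum.map (Eq.trans xy≈) (Eq.trans xy≈) (∧-sel x y)
    where xy≈ = xy≤e⇒xy≈x∧y xy≤e
  ... | inj₂ e≤xy = Sum.map (Eq.trans xy≈) (Eq.trans xy≈) (∨-sel x y)
    where xy≈ = e≤xy⇒xy≈x∨y e≤xy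

  nonnegative-product : ∀ {x y} → e ≤ x → e ≤ y → x · y ≈ x ∨ y
  nonnegative-product e≤x e≤y =
    e≤xy⇒xy≈x∨y (trans (reflexive (Eq.sym (idem e))) (·-mono e≤x e≤y))

  nonpositive-product : ∀ {x y} → x ≤ e → y ≤ e → x · y ≈ x ∧ y
  nonpositive-product x≤e y≤e =
    xy≤e⇒xy≈x∧y (trans (·-mono x≤e y≤e) (reflexive (idem e)))

  nonnegative-comm : ∀ {x y} → e ≤ x → e ≤ y → x · y ≈ y · x
  nonnegative-comm {x} {y} e≤x e≤y =
    Eq.trans (nonnegative-product e≤x e≤y)
      (Eq.trans (∨-comm x y) (Eq.sym (nonnegative-product e≤y e≤x)))

  nonpositive-comm : ∀ {x y} → x ≤ e → y ≤ e → x · y ≈ y · x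
  nonpositive-comm {x} {y} x≤e y≤e =
    Eq.trans (nonpositive-product x≤e y≤e)
      (Eq.trans (∧-comm x y) (Eq.sym (nonpositive-product y≤e x≤e)))

  -- The monoidal preorder and its partners.

  ⊑-isPreorder : IsPreorder _≈_ _⊑_
  ⊑-isPreorder = record
    { isEquivalence = isEquivalence
    ; reflexive     = λ {x} x≈y → Eq.trans (·-congˡ (Eq.sym x≈y)) (idem x)
    ; trans         = ⊑-trans
    }
    where
    open SetoidReasoning setoid
    ⊑-trans : ∀ {x y z} → x ⊑ y → y ⊑ z → x ⊑ z
    ⊑-trans {x} {y} {z} xy≈x yz≈y = begin
      x · z        ≈⟨ ·-congʳ xy≈x ⟨
      (x · y) · z  ≈⟨ assoc x y z ⟩
      x · (y · z)  ≈⟨ ·-congˡ yz≈y ⟩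
      x · y        ≈⟨ xy≈x ⟩
      x            ∎

  ⊑-greatest : ∃! _≈_ (Maximum _⊑_)
  ⊑-greatest = e , identityʳ , λ {y} max → Eq.trans (Eq.sym (max e)) (identityˡ y)

  -- Equivalent partners multiply as a left-zero band. Incomparable ones multiply as a right-zero
  -- band, because a product that is not its left factor must be its right one.
  partner-products : ∀ {a b} → Partner a b →
                     (a · b ≈ a × b · a ≈ b) ⊎ (a · b ≈ b × b · a ≈ a)
  partner-products (_ , inj₁ ⊑⊒) = inj₁ ⊑⊒
  partner-products {a} {b} (_ , inj₂ (a⋢b , b⋢a)) =
    inj₂ ( [ (λ ab≈a → contradiction ab≈a a⋢b) , id ]′ (·-sel a b)
         , [ (λ ba≈b → contradiction ba≈b b⋢a) , id ]′ (·-sel b a))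

  partner-sym : ∀ {a b} → Partner a b → Partner b a
  partner-sym (b≉a , p) =
    b≉a ∘ Eq.sym , Sum.map Product.swap Product.swap p

  partner-noncomm : ∀ {a b} → Partner a b → ¬ (a · b ≈ b · a)
  partner-noncomm p ab≈ba with partner-products p
  ... | inj₁ (ab≈a , ba≈b) =
    proj₁ p (Eq.trans (Eq.sym ba≈b) (Eq.trans (Eq.sym ab≈ba) ab≈a))
  ... | inj₂ (ab≈b , ba≈a) =
    proj₁ p (Eq.trans (Eq.sym ab≈b) (Eq.trans ab≈ba ba≈a))

  -- This is the Green-equivalence of partners: rewriting `a` as `a · (b · a)` lets a second partner
  -- of `a` be expressed through `b`.
  partner-absorbs : ∀ {a b} → Partner a b → a · (b · a) ≈ a
  partner-absorbs {a} p with partner-products p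
  ... | inj₁ (ab≈a , ba≈b) = Eq.trans (·-congˡ ba≈b) ab≈a
  ... | inj₂ (ab≈b , ba≈a) = Eq.trans (·-congˡ ba≈a) (idem a)

  -- Elements on the same side of `e` commute, and partners never do.
  nonnegative⇒partner-nonpositive : ∀ {a b} → Partner a b → e ≤ a → b ≤ e
  nonnegative⇒partner-nonpositive {b = b} p e≤a with total b e
  ... | inj₁ b≤e = b≤e
  ... | inj₂ e≤b = contradiction (nonnegative-comm e≤a e≤b) (partner-noncomm p)

  nonpositive⇒partner-nonnegative : ∀ {a b} → Partner a b → a ≤ e → e ≤ b
  nonpositive⇒partner-nonnegative {b = b} p a≤e with total b e
  ... | inj₂ e≤b = e≤b
  ... | inj₁ b≤e = contradiction (nonpositive-comm a≤e b≤e) (partner-noncomm p)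

  partners-comm : ∀ {a b d} → Partner a b → Partner a d → b · d ≈ d · b
  partners-comm {a} p q with total a e
  ... | inj₁ a≤e = nonnegative-comm (nonpositive⇒partner-nonnegative p a≤e)
                                    (nonpositive⇒partner-nonnegative q a≤e)
  ... | inj₂ e≤a = nonpositive-comm (nonnegative⇒partner-nonpositive p e≤a)
                                    (nonnegative⇒partner-nonpositive q e≤a)

  -- The hypotheses place `b` below `d` in a semilattice of commuting idempotents. Expanding `a` as
  -- `a · (b · a)` inside `d · a` or `a · d` absorbs `d` into `b`, so `d` is `b · a` or `a · b`.
  -- Multiplying `d` by `b` on the matching side then returns `b` by hypothesis and `d` by
  -- idempotence.
  partner-unique-below : ∀ {a b d} → Partner a b → Partner a d →
                         b · d ≈ b → d · b ≈ b → b ≈ d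
  partner-unique-below {a} {b} {d} p q bd≈b db≈b with partner-products q
  ... | inj₁ (_ , da≈d) = begin
    b            ≈⟨ bd≈b ⟨
    b · d        ≈⟨ ·-congˡ d≈ba ⟩
    b · (b · a)  ≈⟨ x·xy≈xy b a ⟩
    b · a        ≈⟨ d≈ba ⟨
    d            ∎
    where
    open SetoidReasoning setoid
    d≈ba : d ≈ b · a
    d≈ba = begin
      d                  ≈⟨ da≈d ⟨
      d · a              ≈⟨ ·-congˡ (partner-absorbs p) ⟨
      d · (a · (b · a))  ≈⟨ assoc d a (b · a) ⟨
      (d · a) · (b · a)  ≈⟨ ·-congʳ da≈d ⟩
      d · (b · a)        ≈⟨ assoc d b a ⟨
      (d · b) · a        ≈⟨ ·-congʳ db≈b ⟩
      b · a              ∎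
  ... | inj₂ (ad≈d , _) = begin
    b            ≈⟨ db≈b ⟨
    d · b        ≈⟨ ·-congʳ d≈ab ⟩
    (a · b) · b  ≈⟨ xy·y≈xy a b ⟩
    a · b        ≈⟨ d≈ab ⟨
    d            ∎
    where
    open SetoidReasoning setoid
    d≈ab : d ≈ a · b
    d≈ab = begin
      d                  ≈⟨ ad≈d ⟨
      a · d              ≈⟨ ·-congʳ (partner-absorbs p) ⟨
      (a · (b · a)) · d  ≈⟨ ·-congʳ (assoc a b a) ⟨
      ((a · b) · a) · d  ≈⟨ assoc (a · b) a d ⟩
      (a · b) · (a · d)  ≈⟨ ·-congˡ ad≈d ⟩
      (a · b) · d        ≈⟨ assoc a b d ⟩
      a · (b · d)        ≈⟨ ·-congˡ bd≈b ⟩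
      a · b              ∎

  -- By conservativity one of the two commuting partners lies below the other.
  partner-unique : ∀ {a b d} → Partner a b → Partner a d → b ≈ d
  partner-unique {b = b} {d} p q with partners-comm p q | ·-sel b d
  ... | bd≈db | inj₁ bd≈b =
    partner-unique-below p q bd≈b (Eq.trans (Eq.sym bd≈db) bd≈b)
  ... | bd≈db | inj₂ bd≈d =
    Eq.sym (partner-unique-below q p (Eq.trans (Eq.sym bd≈db) bd≈d) bd≈d)

  -- A left-zero pair is handled by transitivity. For a right-zero pair, `b · x = x` would force
  -- `x = (a · b) · x = a · x = a`, which is excluded, so conservativity leaves `b · x = b`.
  partner-above : ∀ {a b x} → Partner a b → ¬ (x ≈ a) → a ⊑ x → b ⊑ x
  partner-above {a} {b} {x} p x≉a ax≈a with partner-products p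
  ... | inj₁ (_ , ba≈b) = IsPreorder.trans ⊑-isPreorder ba≈b ax≈a
  ... | inj₂ (ab≈b , _) = [ id , (λ bx≈x → contradiction (x≈a bx≈x) x≉a) ]′ (·-sel b x)
    where
    open SetoidReasoning setoid
    x≈a : b · x ≈ x → x ≈ a
    x≈a bx≈x = begin
      x            ≈⟨ bx≈x ⟨
      b · x        ≈⟨ ·-congʳ ab≈b ⟨
      (a · b) · x  ≈⟨ assoc a b x ⟩
      a · (b · x)  ≈⟨ ·-congˡ bx≈x ⟩
      a · x        ≈⟨ ax≈a ⟩
      a            ∎

  partner-below : ∀ {a b x} → Partner a b → ¬ (x ≈ a) → x ⊑ a → x ⊑ b
  partner-below {a} {b} {x} p x≉a xa≈x with partner-products p
  ... | inj₁ (ab≈a , _) = IsPreorder.trans ⊑-isPreorder xa≈x ab≈a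
  ... | inj₂ (_ , ba≈a) = [ id , (λ xb≈b → contradiction (x≈a xb≈b) x≉a) ]′ (·-sel x b)
    where
    open SetoidReasoning setoid
    x≈a : x · b ≈ b → x ≈ a
    x≈a xb≈b = begin
      x            ≈⟨ xa≈x ⟨
      x · a        ≈⟨ ·-congˡ ba≈a ⟨
      x · (b · a)  ≈⟨ assoc x b a ⟨
      (x · b) · a  ≈⟨ ·-congʳ xb≈b ⟩
      b · a        ≈⟨ ba≈a ⟩
      a            ∎

  -- Lacedness and compatibility of the monoidal preorder.

  module _ (em : ∀ {ℓ} → ExcludedMiddle ℓ) where

    solitary-or-paired : ∀ a → IsSolitary _≈_ _⊑_ a ⊎ ∃! _≈_ (Partner a)
    -- Whether a partner exists is decided classically. If none does, every other `b` is comparable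
    -- with `a`, since an incomparable one would be a partner.
    solitary-or-paired a with em {P = ∃ (Partner a)}
    ... | yes (b , p) = inj₂ (b , p , partner-unique p)
    ... | no  ∄p      = inj₁ λ b b≉a →
      comparable b b≉a , λ a⊑⊒b → ∄p (b , b≉a , inj₁ a⊑⊒b)
      where
      comparable : ∀ b → ¬ (b ≈ a) → a ⊑ b ⊎ b ⊑ a
      comparable b b≉a with em {P = a ⊑ b} | em {P = b ⊑ a}
      ... | yes a⊑b | _       = inj₁ a⊑b
      ... | no  _   | yes b⊑a = inj₂ b⊑a
      ... | no  a⋢b | no  b⋢a = contradiction (b , b≉a , inj₂ (a⋢b , b⋢a)) ∄p

    laced : IsLaced _≈_ _⊑_
    laced = record
      { isPreorder         = ⊑-isPreorder
      ; greatest           = ⊑-greatest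
      ; solitary-or-paired = solitary-or-paired
      ; ♯-above            = ♯-above
      ; ♯-below            = ♯-below
      }
      where
      -- The partner map is spelled out because the record defining it is still under construction;
      -- splitting on `solitary-or-paired a` then makes it compute.
      ♯-above : ∀ a x → ¬ (x ≈ a) →
                let a♯ = [ const a , proj₁ ]′ (solitary-or-paired a) in
                ¬ (x ≈ a♯) → a ⊑ x ⇔ a♯ ⊑ x
      ♯-above a x x≉a x≉a♯ with solitary-or-paired a
      ... | inj₁ _           = mk⇔ id id
      ... | inj₂ (_ , p , _) =
        mk⇔ (partner-above p x≉a) (partner-above (partner-sym p) x≉a♯)

      ♯-below : ∀ a x → ¬ (x ≈ a) →
                let a♯ = [ const a , proj₁ ]′ (solitary-or-paired a) in
                ¬ (x ≈ a♯) → x ⊑ a ⇔ x ⊑ a♯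
      ♯-below a x x≉a x≉a♯ with solitary-or-paired a
      ... | inj₁ _           = mk⇔ id id
      ... | inj₂ (_ , p , _) =
        mk⇔ (partner-below p x≉a) (partner-below (partner-sym p) x≉a♯)

    compatible : IsCompatible _≤_ laced
    compatible = record
      -- A second `⊑`-least `y` satisfies `y = y · b`, and `y · b` is `b` by absorption on the other
      -- side.
      { least    = λ b b≤ → least-absorbs b≤ , λ y y⊑ →
          Eq.trans (Eq.sym (y⊑ b)) (antisym (least-absorbsʳ b≤ y) (b≤ _))
      ; positive = λ x y e≤x e≤y →
          let yx≈y∨x = nonnegative-product e≤y e≤x in
          mk⇔ (λ x≤y → Eq.trans yx≈y∨x (Eq.trans (∨-comm y x) (x≤y⇒x∨y≈y x≤y)))
              (λ y⊑x → trans (y≤x∨y y x)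
                         (reflexive (Eq.trans (Eq.sym yx≈y∨x) y⊑x)))
      ; negative = λ x y x≤e y≤e →
          let xy≈x∧y = nonpositive-product x≤e y≤e in
          mk⇔ (λ x≤y → Eq.trans xy≈x∧y (Eq.trans (∧-comm x y) (y≤x⇒x∧y≈y x≤y)))
              (λ x⊑y → trans (reflexive (Eq.trans (Eq.sym x⊑y) xy≈x∧y))
                         (x∧y≤y x y))
      ; opposite = opposite
      }
      where
      -- Residuation turns `b · y ≤ b` into `b ≤ b // y`, an instance of minimality.
      least-absorbs : ∀ {b} → Minimum _≤_ b → Minimum _⊑_ b
      least-absorbs {b} b≤ y =
        antisym (from (isRightResidual b y b) (b≤ (b // y))) (b≤ _)

      least-absorbsʳ : ∀ {b} → Minimum _≤_ b → ∀ y → y · b ≤ b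
      least-absorbsʳ {b} b≤ y = to (isLeftResidual y b b) (b≤ (y \\ b))

      opposite : ∀ x → let x♯ = [ const x , proj₁ ]′ (solitary-or-paired x) in
                 ¬ (x ≈ x♯) → e ≤ x ⇔ x♯ ≤ e
      opposite x x≉x♯ with solitary-or-paired x
      ... | inj₁ _           = contradiction Eq.refl x≉x♯
      ... | inj₂ (_ , p , _) =
        mk⇔ (nonnegative⇒partner-nonpositive p)
            (nonpositive⇒partner-nonnegative (partner-sym p))

-- Principal down-sets in a finite chain.

module FinitePrincipal
  {c ℓ₁ ℓ₂} (𝐂 : Chain c ℓ₁ ℓ₂)
  (finite : IsFinite (Chain.≈-setoid 𝐂)) (x₀ : Chain.Carrier 𝐂)
  where

  open Chain 𝐂

  open Inverse (proj₂ finite) renaming (to to index; from to element)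

  private
    totalOrder : TotalOrder c ℓ₁ ℓ₂
    totalOrder = record
      { isTotalOrder = record { isPartialOrder = isPartialOrder ; total = total } }

  open Extrema totalOrder

  elements : List Carrier
  elements = map element (allFin (proj₁ finite))

  -- List membership is propositional while the carrier is a setoid, so the round trip through `Fin`
  -- provides a listed element equal to `x` up to `_≈_`.
  representative : Carrier → Carrier
  representative x = element (index x)

  representative≈ : ∀ x → representative x ≈ x
  representative≈ = strictlyInverseʳ

  representative∈elements : ∀ x → representative x ∈ elements
  representative∈elements x = ∈-map⁺ element (∈-allFin (index x))

  bottom : Carrier
  -- `x₀` is the starting value of the fold; it is itself `_≈_` to a listed element.
  bottom = min x₀ elements

  bottom-minimum : Minimum _≤_ bottom
  bottom-minimum x =
    trans (All.lookup (min≤xs x₀ elements) (representative∈elements x))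
          (reflexive (representative≈ x))

  principal : ∀ {p} {P : Unary.Pred Carrier p} → Unary.Decidable P →
              (∀ {x y} → x ≤ y → P y → P x) → P bottom →
              ∃ λ g → ∀ x → x ≤ g ⇔ P x
  principal {P = P} P? down P⊥ = g , λ x → mk⇔ (λ x≤g → down x≤g Pg) (x≤g x)
    where
    g : Carrier
    -- Starting the fold at `bottom` keeps `g` inside `P` even when the filtered list is empty.
    g = max bottom (filter P? elements)
    Pg : P g
    Pg = argmax-all id {P = P} P⊥ (all-filter P? elements)
    x≤g : ∀ x → P x → x ≤ g
    x≤g x Px =
      trans (reflexive (Eq.sym (representative≈ x)))
        (All.lookup (xs≤max bottom (filter P? elements))
          (∈-filter⁺ P? (representative∈elements x)
            (down (reflexive (representative≈ x)) Px)))

-- The product of a compatible laced preorder.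

module LacedProduct
  {c ℓ₁ ℓ₂ ℓ₃} (𝐂 : Chain c ℓ₁ ℓ₂) {_⊑_ : Rel (Chain.Carrier 𝐂) ℓ₃}
  (laced : IsLaced (Chain._≈_ 𝐂) _⊑_) (compatible : IsCompatible (Chain._≤_ 𝐂) laced)
  (_≟_ : Decidable (Chain._≈_ 𝐂)) (_⊑?_ : Decidable _⊑_)
  where

  open Chain 𝐂
  open IsLaced laced hiding (isPreorder)
  open IsPreorder (IsLaced.isPreorder laced) using ()
    renaming (refl to ⊑-refl; trans to ⊑-trans; reflexive to ⊑-reflexive)
  open IsCompatible compatible

  infixr 7 _·_
  _·_ : Op₂ Carrier
  _·_ = product _⊑?_

  x⊑y⇒xy≡x : ∀ {x y} → x ⊑ y → x · y ≡ x
  x⊑y⇒xy≡x {x} {y} x⊑y with x ⊑? y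
  ... | yes _   = ≡.refl
  ... | no  x⋢y = contradiction x⊑y x⋢y

  x⋢y⇒xy≡y : ∀ {x y} → ¬ (x ⊑ y) → x · y ≡ y
  x⋢y⇒xy≡y {x} {y} x⋢y with x ⊑? y
  ... | yes x⊑y = contradiction x⊑y x⋢y
  ... | no  _   = ≡.refl

  ·-idem : ∀ x → x · x ≈ x
  ·-idem x = Eq.reflexive (x⊑y⇒xy≡x ⊑-refl)

  ·-identityˡ : ∀ x → e · x ≈ x
  ·-identityˡ x with e ⊑? x
  -- Here `x` lies above `e`, hence is itself greatest and equals `e` by uniqueness.
  ... | yes e⊑x = proj₂ (proj₂ greatest) λ y → ⊑-trans (proj₁ (proj₂ greatest) y) e⊑x
  ... | no  _   = Eq.refl

  ·-identityʳ : ∀ x → x · e ≈ x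
  ·-identityʳ x = Eq.reflexive (x⊑y⇒xy≡x (proj₁ (proj₂ greatest) x))

  -- An element incomparable with `x` is a partner of `x`, and uniqueness identifies it with `x ♯`.
  comparable : ∀ {x y} → ¬ (y ≈ x) → ¬ (y ≈ x ♯) → x ⊑ y ⊎ y ⊑ x
  comparable {x} {y} y≉x y≉x♯ with solitary-or-paired x
  ... | inj₁ solitary = proj₁ (solitary y y≉x)
  ... | inj₂ (_ , _ , unique) with x ⊑? y | y ⊑? x
  ...   | yes x⊑y | _       = inj₁ x⊑y
  ...   | no  _   | yes y⊑x = inj₂ y⊑x
  ...   | no  x⋢y | no  y⋢x =
    contradiction (Eq.sym (unique (y≉x , inj₂ (x⋢y , y⋢x)))) y≉x♯

  -- This is the crux of associativity. Suppose `z` differs from `x`. If `y` is `x ♯`, lacing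
  -- transfers `x ⊑ z` to `y ⊑ z`. Otherwise `x` and `y` are comparable, so `y ⊑ x ⊑ z`. Both
  -- contradict `¬ (y ⊑ z)`.
  ⋢-trans : ∀ {x y z} → ¬ (x ⊑ y) → ¬ (y ⊑ z) → x ⊑ z → z ≈ x
  ⋢-trans {x} {y} {z} x⋢y y⋢z x⊑z with z ≟ x | y ≟ (x ♯)
  ... | yes z≈x | _        = z≈x
  ... | no  z≉x | yes y≈x♯ =
    contradiction (⊑-trans (⊑-reflexive y≈x♯) (to (♯-above x z z≉x z≉x♯) x⊑z)) y⋢z
    where
    z≉x♯ : ¬ (z ≈ x ♯)
    z≉x♯ z≈x♯ = y⋢z (⊑-reflexive (Eq.trans y≈x♯ (Eq.sym z≈x♯)))
  ... | no  _   | no  y≉x♯ =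
    [ (λ x⊑y → contradiction x⊑y x⋢y)
    , (λ y⊑x → contradiction (⊑-trans y⊑x x⊑z) y⋢z)
    ]′ (comparable (λ y≈x → x⋢y (⊑-reflexive (Eq.sym y≈x))) y≉x♯)

  ·-assoc : ∀ x y z → (x · y) · z ≈ x · (y · z)
  ·-assoc x y z with x ⊑? y | y ⊑? z
  ... | yes x⊑y | yes y⊑z =
    Eq.reflexive (≡.trans (x⊑y⇒xy≡x (⊑-trans x⊑y y⊑z)) (≡.sym (x⊑y⇒xy≡x x⊑y)))
  ... | yes _   | no  _   = Eq.refl
  ... | no  x⋢y | yes y⊑z =
    Eq.reflexive (≡.trans (x⊑y⇒xy≡x y⊑z) (≡.sym (x⋢y⇒xy≡y x⋢y)))
  -- The left bracketing yields `z`, while the right one reduces to `x · z`, which is `x` when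
  -- `x ⊑ z`.
  ... | no  x⋢y | no  y⋢z with x ⊑? z
  ...   | yes x⊑z = Eq.trans (Eq.reflexive (x⋢y⇒xy≡y y⋢z)) (⋢-trans x⋢y y⋢z x⊑z)
  ...   | no  _   = Eq.reflexive (x⋢y⇒xy≡y y⋢z)

  -- Only the cases where the two products choose different factors need work. If all elements
  -- compared lie on one side of `e`, compatibility translates between `≤` and `⊑`. If `e` separates
  -- `y` from `x` and `x′`, those two are compared on their own side and transitivity of `⊑` carries
  -- the result to `y`.
  ·-monoˡ : ∀ {x x′} y → x ≤ x′ → x · y ≤ x′ · y
  ·-monoˡ {x} {x′} y x≤x′ with x ⊑? y | x′ ⊑? y
  ... | yes _   | yes _    = x≤x′
  ... | no  _   | no  _    = refl
  ... | yes x⊑y | no  x′⋢y with total x y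
  ...   | inj₁ x≤y = x≤y
  ...   | inj₂ y≤x with total e y | total e x
  ...     | inj₁ e≤y | _        =
    contradiction (to (positive y x′ e≤y (trans e≤y y≤x′)) y≤x′) x′⋢y
    where y≤x′ = trans y≤x x≤x′
  ...     | inj₂ y≤e | inj₂ x≤e = from (negative x y x≤e y≤e) x⊑y
  ...     | inj₂ _   | inj₁ e≤x =
    contradiction (⊑-trans (to (positive x x′ e≤x (trans e≤x x≤x′)) x≤x′) x⊑y) x′⋢y
  ·-monoˡ {x} {x′} y x≤x′ | no x⋢y | yes x′⊑y with total y x′
  ...   | inj₁ y≤x′ = y≤x′
  ...   | inj₂ x′≤y with total e y | total e x′
  ...     | inj₂ y≤e | _         =
    contradiction (to (negative x y (trans x≤y y≤e) y≤e) x≤y) x⋢y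
    where x≤y = trans x≤x′ x′≤y
  ...     | inj₁ e≤y | inj₁ e≤x′ = from (positive y x′ e≤y e≤x′) x′⊑y
  ...     | inj₁ _   | inj₂ x′≤e =
    contradiction (⊑-trans (to (negative x x′ (trans x≤x′ x′≤e) x′≤e) x≤x′) x′⊑y) x⋢y

  ·-monoʳ : ∀ y {x x′} → x ≤ x′ → y · x ≤ y · x′
  ·-monoʳ y {x} {x′} x≤x′ with y ⊑? x | y ⊑? x′
  ... | yes _   | yes _    = refl
  ... | no  _   | no  _    = x≤x′
  ... | yes y⊑x | no  y⋢x′ with total y x′
  ...   | inj₁ y≤x′ = y≤x′
  ...   | inj₂ x′≤y with total e y | total e x′
  ...     | inj₂ y≤e | _         =
    trans (from (negative y x y≤e (trans (trans x≤x′ x′≤y) y≤e)) y⊑x) x≤x′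
  ...     | inj₁ e≤y | inj₁ e≤x′ = contradiction (to (positive x′ y e≤x′ e≤y) x′≤y) y⋢x′
  ...     | inj₁ _   | inj₂ x′≤e =
    contradiction (⊑-trans y⊑x (to (negative x x′ (trans x≤x′ x′≤e) x′≤e) x≤x′)) y⋢x′
  ·-monoʳ y {x} {x′} x≤x′ | no y⋢x | yes y⊑x′ with total x y
  ...   | inj₁ x≤y = x≤y
  ...   | inj₂ y≤x with total e y | total e x
  ...     | inj₁ e≤y | _        =
    trans x≤x′ (from (positive x′ y (trans e≤y (trans y≤x x≤x′)) e≤y) y⊑x′)
  ...     | inj₂ y≤e | inj₂ x≤e = contradiction (to (negative y x y≤e x≤e) y≤x) y⋢x
  ...     | inj₂ _   | inj₁ e≤x =
    contradiction (⊑-trans y⊑x′ (to (positive x x′ e≤x (trans e≤x x≤x′)) x≤x′)) y⋢x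

  ·-mono : Monotonic₂ _≤_ _≤_ _≤_ _·_
  ·-mono {x} {x′} {y} {y′} x≤x′ y≤y′ = trans (·-monoˡ y x≤x′) (·-monoʳ x′ y≤y′)

  isIdempotentMonoid : IsIdempotentMonoid _≈_ _·_ e
  isIdempotentMonoid = record
    { isMonoid = record
      { isSemigroup = record
        { isMagma = record
          { isEquivalence = isEquivalence
          -- Monotonicity in both directions avoids comparing the decisions of `⊑` at equal
          -- arguments.
          ; ∙-cong        = λ x≈x′ y≈y′ →
              antisym (·-mono (reflexive x≈x′) (reflexive y≈y′))
                      (·-mono (reflexive (Eq.sym x≈x′)) (reflexive (Eq.sym y≈y′)))
          }
        ; assoc = ·-assoc
        }
      ; identity = ·-identityˡ , ·-identityʳ
      }
    ; idem = ·-idem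
    }

  isIdempotentTotallyOrderedMonoid :
    IsIdempotentTotallyOrderedMonoid _≈_ _≤_ _∨_ _∧_ _·_ e
  isIdempotentTotallyOrderedMonoid = record
    { isChain            = isChain
    ; isIdempotentMonoid = isIdempotentMonoid
    ; ·-mono             = ·-mono
    }

  least-zeroˡ : ∀ {b} → Minimum _≤_ b → ∀ x → b · x ≈ b
  least-zeroˡ {b} b≤ x = Eq.reflexive (x⊑y⇒xy≡x (proj₁ (least b b≤) x))

  -- If `x ⊑ b`, then `x` is `⊑`-least as well, so the uniqueness in `least` identifies it with `b`.
  least-zeroʳ : ∀ {b} → Minimum _≤_ b → ∀ x → x · b ≈ b
  least-zeroʳ {b} b≤ x with x ⊑? b
  ... | yes x⊑b = proj₂ (least b b≤) x λ y → ⊑-trans x⊑b (proj₁ (least b b≤) y)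
  ... | no  _   = Eq.refl

  -- Residuals over a finite chain.

  module _ (_≤?_ : Decidable _≤_) (finite : IsFinite ≈-setoid) where

    open FinitePrincipal 𝐂 finite e

    -- The value at `x` and `z` is the top of the down-set of all `y` with `x · y ≤ z`, which
    -- contains `bottom` because `bottom` is a right zero. Any other residual has the same down-set,
    -- hence the same top.
    leftResidual : ∃! (PointwiseEqual₂ _≈_) (IsLeftResidual _≤_ _·_)
    leftResidual =
      (λ x z → proj₁ (residual x z)) ,
      (λ x y z → proj₂ (residual x z) y) ,
      λ isLeftResidual x z →
        antisym (from (isLeftResidual x _ z) (to (proj₂ (residual x z) _) refl))
                (from (proj₂ (residual x z) _) (to (isLeftResidual x _ z) refl))
      where
      residual : ∀ x z → ∃ λ g → ∀ y → y ≤ g ⇔ x · y ≤ z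
      residual x z = principal (λ y → (x · y) ≤? z)
        (λ y≤y′ → trans (·-monoʳ x y≤y′))
        (trans (reflexive (least-zeroʳ bottom-minimum x)) (bottom-minimum z))

    rightResidual : ∃! (PointwiseEqual₂ _≈_) (IsRightResidual _≤_ _·_)
    rightResidual =
      (λ z y → proj₁ (residual z y)) ,
      (λ x y z → ⇔.sym (proj₂ (residual z y) x)) ,
      λ isRightResidual z y →
        antisym (to (isRightResidual _ y z) (to (proj₂ (residual z y) _) refl))
                (from (proj₂ (residual z y) _) (from (isRightResidual _ y z) refl))
      where
      residual : ∀ z y → ∃ λ g → ∀ x → x ≤ g ⇔ x · y ≤ z
      residual z y = principal (λ x → (x · y) ≤? z)
        (λ x≤x′ → trans (·-monoˡ y x≤x′))
        (trans (reflexive (least-zeroˡ bottom-minimum y)) (bottom-minimum z))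

    isIdempotentResiduatedChain :
      IsIdempotentResiduatedChain _≈_ _≤_ _∨_ _∧_ _·_
        (proj₁ leftResidual) (proj₁ rightResidual) e
    isIdempotentResiduatedChain = record
      { isResiduatedLattice = record
        { isLattice       = isLattice
        ; isMonoid        = IsIdempotentMonoid.isMonoid isIdempotentMonoid
        ; isLeftResidual  = proj₁ (proj₂ leftResidual)
        ; isRightResidual = proj₁ (proj₂ rightResidual)
        }
      ; idem  = ·-idem
      ; total = total
      }

theorem4p3 :
  (em : ∀ {ℓ} → ExcludedMiddle ℓ) →
  ∀ {c ℓ₁ ℓ₂ ℓ₃} →
  (∀ (𝐀 : IdempotentResiduatedChain c ℓ₁ ℓ₂) →
    let open IdempotentResiduatedChain 𝐀 in
    Σ (IsLaced _≈_ _⊑_) λ laced → IsCompatible _≤_ laced)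
  ×
  (∀ (𝐂 : Chain c ℓ₁ ℓ₂) →
    let open Chain 𝐂 in
    ∀ (_⊑_ : Rel Carrier ℓ₃) (laced : IsLaced _≈_ _⊑_) → IsCompatible _≤_ laced →
    let e   = IsLaced.e laced
        _·_ = product {_⊑_ = _⊑_} (λ x y → em)
    in
    IsIdempotentTotallyOrderedMonoid _≈_ _≤_ _∨_ _∧_ _·_ e
    ×
    (IsFinite ≈-setoid →
      Σ (∃! (PointwiseEqual₂ _≈_) (IsLeftResidual _≤_ _·_)) λ left →
      Σ (∃! (PointwiseEqual₂ _≈_) (IsRightResidual _≤_ _·_)) λ right →
      IsIdempotentResiduatedChain _≈_ _≤_ _∨_ _∧_ _·_ (proj₁ left) (proj₁ right) e))
theorem4p3 em =
  (λ 𝐀 → let open MonoidalPreorder 𝐀 in laced em , compatible em) ,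
  λ 𝐂 _⊑_ laced compatible →
    let open LacedProduct 𝐂 laced compatible (λ x y → em) (λ x y → em)
    in isIdempotentTotallyOrderedMonoid ,
       λ finite →
         leftResidual (λ x y → em) finite ,
         rightResidual (λ x y → em) finite ,
         isIdempotentResiduatedChain (λ x y → em) finite
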